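{- Let $\mathcal{H}$ be a family of graphs. There is a constant $C=C(\mathcal{H})$ such that $$\#\{v\in V(G):\deg(v)\ge 2\}\le C$$ for every connected $\mathcal{H}$-free graph $G$ if and only if $$\mathcal{H}\le \{K_n,\ P_n,\ K_{1,n}^*,\ K_{2,n},\ K_2+nK_1,\ K_1+nK_2\}$$ for some positive integer $n$.
   Context: All graphs are finite, undirected and simple. For graphs $H_1,H_2$, write $H_1\le H_2$ if $H_1$ is (isomorphic to) an induced subgraph of $H_2$. A graph $G$ is $\mathcal{H}$-free if there is no $H\in\mathcal{H}$ with $H\le G$. For families of graphs $\mathcal{H}_1,\mathcal{H}_2$, write $\mathcal{H}_1\le\mathcal{H}_2$ if for every $H_2\in\mathcal{H}_2$ there is $H_1\in\mathcal{H}_1$ with $H_1\le H_2$. $K_n$ is the complete graph on $n$ vertices, $P_n$ the path on $n$ vertices, $K_{s,t}$ the complete bipartite graph. $G_1+G_2$ denotes the join of $G_1$ and $G_2$: the graph with vertex set $V(G_1)\sqcup V(G_2)$ whose edges are those of $G_1$, those of $G_2$, and all pairs $\{x,y\}$ with $x\in V(G_1)$, $y\in V(G_2)$. $nG$ denotes the disjoint union of $n$ copies of $G$ (in $G_1+nG_2$ this is formed before the join). $K_{1,n}^*$ is the graph obtained from the star $K_{1,n}$ by attaching one pendant vertex to each of its $n$ leaves. -}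

module Defs where

open import Data.Empty using (⊥)
open import Data.Fin.Base using (Fin; toℕ)
open import Data.Fin.Properties using (+↔⊎; *↔×) renaming (_≟_ to _≟ᶠ_)
open import Data.List.Base using (List; allFin; filter; length; map)
open import Data.Nat.Base using (ℕ; suc; _+_; _*_; _≤_)
open import Data.Nat.Properties using (_≟_; _≤?_; 1+n≢n)
open import Data.Product.Base using (Σ-syntax; ∃-syntax; _×_; _,_)
open import Data.Product.Function.NonDependent.Propositional using (_×-↔_)
open import Data.Sum.Base using (_⊎_; inj₁; inj₂; swap; [_,_]′)
open import Data.Sum.Function.Propositional using (_⊎-↔_)
open import Data.Unit.Base using (⊤; tt)
open import Function.Bundles using (_↔_; _⇔_; Inverse)
open import Function.Definitions using (Injective)
open import Function.Properties.Inverse using (↔-refl; ↔-trans)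
open import Level using (0ℓ)
open import Relation.Binary.Construct.Closure.ReflexiveTransitive using (Star)
open import Relation.Binary.Core using (Rel)
open import Relation.Binary.Definitions using (Decidable; Irreflexive; Symmetric)
open import Relation.Binary.PropositionalEquality using (_≡_; _≢_; refl; sym; ≢-sym)
open import Relation.Nullary.Decidable using (yes; no; ¬?; _×-dec_; _⊎-dec_)
open import Relation.Nullary.Negation using (¬_)
open import Relation.Unary using (Pred; _∈_)

record Graph : Set₁ where
  infix 4 _~_
  field
    Vertex   : Set
    order    : ℕ
    enum     : Fin order ↔ Vertex
    _~_      : Rel Vertex 0ℓ
    _~?_     : Decidable _~_
    ~-sym    : Symmetric _~_
    ~-irrefl : Irreflexive _≡_ _~_

  vertices : List Vertex
  vertices = map (Inverse.to enum) (allFin order)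

  degree : Vertex → ℕ
  degree v = length (filter (v ~?_) vertices)

  #degree≥2 : ℕ
  #degree≥2 = length (filter (λ v → 2 ≤? degree v) vertices)

open Graph using (Vertex; #degree≥2)

Connected : Graph → Set
Connected G = ∀ u v → Star (Graph._~_ G) u v

infix 4 _≤ᴳ_ _≼_

_≤ᴳ_ : Graph → Graph → Set
H ≤ᴳ G = Σ[ f ∈ (Vertex H → Vertex G) ]
           Injective _≡_ _≡_ f × (∀ u v → (u H.~ v) ⇔ (f u G.~ f v))
  where
  module H = Graph H
  module G = Graph G

_-Free : ∀ {ℓ} → Pred Graph ℓ → Pred Graph _
(ℋ -Free) G = ¬ (∃[ H ] H ∈ ℋ × H ≤ᴳ G)

_≼_ : ∀ {ℓ₁ ℓ₂} → Pred Graph ℓ₁ → Pred Graph ℓ₂ → Set _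
ℋ₁ ≼ ℋ₂ = ∀ H₂ → H₂ ∈ ℋ₂ → ∃[ H₁ ] H₁ ∈ ℋ₁ × H₁ ≤ᴳ H₂

K : ℕ → Graph
K n = record
  { Vertex   = Fin n
  ; order    = n
  ; enum     = ↔-refl
  ; _~_      = _≢_
  ; _~?_     = λ u v → ¬? (u ≟ᶠ v)
  ; ~-sym    = ≢-sym
  ; ~-irrefl = λ u≡v u≢v → u≢v u≡v
  }

P : ℕ → Graph
P n = record
  { Vertex   = Fin n
  ; order    = n
  ; enum     = ↔-refl
  ; _~_      = λ u v → suc (toℕ u) ≡ toℕ v ⊎ suc (toℕ v) ≡ toℕ u
  ; _~?_     = λ u v → (suc (toℕ u) ≟ toℕ v) ⊎-dec (suc (toℕ v) ≟ toℕ u)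
  ; ~-sym    = swap
  ; ~-irrefl = λ { refl → [ 1+n≢n , 1+n≢n ]′ }
  }

K[_,_] : ℕ → ℕ → Graph
K[ s , t ] = record
  { Vertex   = Fin s ⊎ Fin t
  ; order    = s + t
  ; enum     = +↔⊎
  ; _~_      = _~_
  ; _~?_     = dec
  ; ~-sym    = λ {u} {v} → symm u v
  ; ~-irrefl = λ { {u} refl → irr u }
  }
  where
  _~_ : Rel (Fin s ⊎ Fin t) 0ℓ
  inj₁ _ ~ inj₁ _ = ⊥
  inj₁ _ ~ inj₂ _ = ⊤
  inj₂ _ ~ inj₁ _ = ⊤
  inj₂ _ ~ inj₂ _ = ⊥

  dec : Decidable _~_
  dec (inj₁ _) (inj₁ _) = no λ ()
  dec (inj₁ _) (inj₂ _) = yes tt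
  dec (inj₂ _) (inj₁ _) = yes tt
  dec (inj₂ _) (inj₂ _) = no λ ()

  symm : ∀ u v → u ~ v → v ~ u
  symm (inj₁ _) (inj₂ _) _ = tt
  symm (inj₂ _) (inj₁ _) _ = tt

  irr : ∀ u → ¬ (u ~ u)
  irr (inj₁ _) ()
  irr (inj₂ _) ()

-- inj₁ (inj₁ zero) is the centre of the star, inj₁ (inj₂ i) its i-th leaf,
-- and inj₂ i the pendant vertex attached to that leaf.
K*[1,_] : ℕ → Graph
K*[1, n ] = record
  { Vertex   = S.Vertex ⊎ Fin n
  ; order    = S.order + n
  ; enum     = ↔-trans +↔⊎ (S.enum ⊎-↔ ↔-refl)
  ; _~_      = _~_
  ; _~?_     = dec
  ; ~-sym    = λ {u} {v} → symm u v
  ; ~-irrefl = λ { {u} refl → irr u }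
  }
  where
  module S = Graph K[ 1 , n ]

  _~_ : Rel (S.Vertex ⊎ Fin n) 0ℓ
  inj₁ u        ~ inj₁ v        = u S.~ v
  inj₁ (inj₁ _) ~ inj₂ _        = ⊥
  inj₁ (inj₂ i) ~ inj₂ j        = i ≡ j
  inj₂ _        ~ inj₁ (inj₁ _) = ⊥
  inj₂ i        ~ inj₁ (inj₂ j) = i ≡ j
  inj₂ _        ~ inj₂ _        = ⊥

  dec : Decidable _~_
  dec (inj₁ u)        (inj₁ v)        = u S.~? v
  dec (inj₁ (inj₁ _)) (inj₂ _)        = no λ ()
  dec (inj₁ (inj₂ i)) (inj₂ j)        = i ≟ᶠ j
  dec (inj₂ _)        (inj₁ (inj₁ _)) = no λ ()
  dec (inj₂ i)        (inj₁ (inj₂ j)) = i ≟ᶠ j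
  dec (inj₂ _)        (inj₂ _)        = no λ ()

  symm : ∀ u v → u ~ v → v ~ u
  symm (inj₁ u)        (inj₁ v)        u~v = S.~-sym {u} {v} u~v
  symm (inj₁ (inj₂ _)) (inj₂ _)        i≡j = sym i≡j
  symm (inj₂ _)        (inj₁ (inj₂ _)) i≡j = sym i≡j

  irr : ∀ u → ¬ (u ~ u)
  irr (inj₁ u) u~u = S.~-irrefl {u} refl u~u
  irr (inj₂ _) ()

infixl 6 _+ᴳ_
infixl 7 _·_

-- Join, not disjoint union.
_+ᴳ_ : Graph → Graph → Graph
G₁ +ᴳ G₂ = record
  { Vertex   = G₁.Vertex ⊎ G₂.Vertex
  ; order    = G₁.order + G₂.order
  ; enum     = ↔-trans +↔⊎ (G₁.enum ⊎-↔ G₂.enum)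
  ; _~_      = _~_
  ; _~?_     = dec
  ; ~-sym    = λ {u} {v} → symm u v
  ; ~-irrefl = λ { {u} refl → irr u }
  }
  where
  module G₁ = Graph G₁
  module G₂ = Graph G₂

  _~_ : Rel (G₁.Vertex ⊎ G₂.Vertex) 0ℓ
  inj₁ u ~ inj₁ v = u G₁.~ v
  inj₁ _ ~ inj₂ _ = ⊤
  inj₂ _ ~ inj₁ _ = ⊤
  inj₂ u ~ inj₂ v = u G₂.~ v

  dec : Decidable _~_
  dec (inj₁ u) (inj₁ v) = u G₁.~? v
  dec (inj₁ _) (inj₂ _) = yes tt
  dec (inj₂ _) (inj₁ _) = yes tt
  dec (inj₂ u) (inj₂ v) = u G₂.~? v

  symm : ∀ u v → u ~ v → v ~ u
  symm (inj₁ _) (inj₁ _) u~v = G₁.~-sym u~v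
  symm (inj₁ _) (inj₂ _) _   = tt
  symm (inj₂ _) (inj₁ _) _   = tt
  symm (inj₂ _) (inj₂ _) u~v = G₂.~-sym u~v

  irr : ∀ u → ¬ (u ~ u)
  irr (inj₁ _) = G₁.~-irrefl refl
  irr (inj₂ _) = G₂.~-irrefl refl

-- Disjoint union of n copies of G.
_·_ : ℕ → Graph → Graph
n · G = record
  { Vertex   = Fin n × G.Vertex
  ; order    = n * G.order
  ; enum     = ↔-trans *↔× (↔-refl ×-↔ G.enum)
  ; _~_      = λ { (i , u) (j , v) → i ≡ j × u G.~ v }
  ; _~?_     = λ { (i , u) (j , v) → (i ≟ᶠ j) ×-dec (u G.~? v) }
  ; ~-sym    = λ { (i≡j , u~v) → sym i≡j , G.~-sym u~v }
  ; ~-irrefl = λ { refl (_ , u~u) → G.~-irrefl refl u~u }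
  }
  where module G = Graph G

{-# OPTIONS --safe #-}

-- If the number of vertices of degree at least 2 ("branching") is bounded for ℋ-free connected
-- graphs, the six graphs with n = C + 3 exceed the bound and so contain members of ℋ.
-- Conversely, let G be connected and avoid the six graphs. Any two branching vertices are joined
-- by an induced path, which has branching vertices only and is short since G avoids P n. So a
-- large number of branching vertices forces a vertex v with many branching neighbours u, each
-- with a further neighbour w ≠ v. By Ramsey, many of these legs v - u - w can be chosen so that
-- the adjacencies among the u's and w's of distinct legs are homogeneous in list order. Adjacent
-- u's or w's give K n; a w adjacent to the u's of many other legs is, with v, a pair of hubs
-- giving K[ 2 , n ] or K 2 +ᴳ n · K 1; and legs that are entirely apart give K*[1, n ] or
-- K 1 +ᴳ n · K 2 according to whether v is adjacent to the w's.
module Submission where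

open import Defs
open import Axiom.ExcludedMiddle using (ExcludedMiddle)
open import Data.Fin.Base using (Fin; zero; suc; toℕ; inject≤; inject₁)
open import Data.Fin.Induction using (<-weakInduction)
open import Data.Fin.Patterns using (0F; 1F)
open import Data.Fin.Properties as Fin using
  (injective⇒≤; inject≤-injective; toℕ-inject≤; toℕ-inject₁; toℕ-injective)
open import Data.List.Base using
  (List; _∷_; []; [_]; length; filter; map; lookup; concatMap)
open import Data.List.Membership.Propositional using (lose) renaming (_∈_ to _∈ˡ_)
open import Data.List.Membership.Propositional.Properties using
  (∈-map⁺; ∈-allFin; ∈-filter⁺; ∈-filter⁻; ∈-lookup; ∈-concatMap⁺; ∈-tabulate⁻)
open import Data.List.Properties using (length-map; length-++; length-tabulate)
open import Data.List.Relation.Binary.Sublist.Propositional using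
  (_⊆_; []; _∷_; _∷ʳ_; ⊆-trans; minimum)
open import Data.List.Relation.Binary.Sublist.Propositional.Properties using
  (All-resp-⊆; filter-⊆)
open import Data.List.Relation.Unary.All as All using (All; []; _∷_)
open import Data.List.Relation.Unary.All.Properties using (all-filter; ¬Any⇒All¬)
open import Data.List.Relation.Unary.AllPairs as AllPairs using (AllPairs; []; _∷_)
import Data.List.Relation.Unary.AllPairs.Properties as AllPairs
open import Data.List.Relation.Unary.Any using (Any; here; there; any?; index)
open import Data.List.Relation.Unary.Any.Properties using (lookup-index)
open import Data.List.Relation.Unary.Unique.Propositional using (Unique)
import Data.List.Relation.Unary.Unique.Propositional.Properties as Unique
open import Data.Nat.Base using (ℕ; zero; suc; _+_; _*_; _≤_; _<_; _>_; z≤n; s≤s; z<s)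
open import Data.Nat.Properties as ℕ using
  (≤-refl; ≤-trans; ≤-reflexive; +-mono-≤; +-mono-<; *-monoˡ-≤; <⇒≤; <⇒≢; <⇒≱; ≰⇒>; ≮⇒≥; _≤?_;
   <-cmp; suc-injective)
open import Data.Product.Base using (∃-syntax; Σ-syntax; _×_; _,_; proj₁; proj₂)
open import Data.Sum.Base as Sum using (_⊎_; inj₁; inj₂; [_,_]′)
open import Data.Unit.Base using (tt)
open import Function.Base using (_∘_; _on_; flip; case_of_)
open import Function.Bundles using (_⇔_; mk⇔; Inverse; Equivalence)
open import Function.Definitions using (Injective)
open import Level using (Level; _⊔_; 0ℓ) renaming (suc to lsuc)
open import Relation.Binary.Construct.Closure.ReflexiveTransitive using (Star; ε; _◅_; _◅◅_; reverse)
open import Relation.Binary.Core using (Rel)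
open import Relation.Binary.Definitions using (Decidable; DecidableEquality; Symmetric; tri<; tri≈; tri>)
open import Relation.Binary.PropositionalEquality using
  (_≡_; _≢_; refl; sym; trans; cong; subst; subst₂; ≢-sym)
open import Relation.Nullary.Decidable using
  (Dec; yes; no; ¬?; _×-dec_; _⊎-dec_; map′; decidable-stable)
open import Relation.Nullary.Negation using (¬_; contradiction)
open import Relation.Unary using (Pred; _∈_)

-- Lists: pairwise relations, sublists and counting.

private
  variable
    a ℓ : Level
    A B : Set a
    n : ℕ
    xs ys : List A

AllPairs-resp-⊆ : {R : Rel A ℓ} → xs ⊆ ys → AllPairs R ys → AllPairs R xs
AllPairs-resp-⊆ []         []         = []
AllPairs-resp-⊆ (_ ∷ʳ τ)   (_ ∷ rs)   = AllPairs-resp-⊆ τ rs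
AllPairs-resp-⊆ (refl ∷ τ) (r ∷ rs)   = All-resp-⊆ τ r ∷ AllPairs-resp-⊆ τ rs

-- `AllPairs` records pairs in list order only; symmetry supplies the reversed ones.
AllPairs-lookup : {R : Rel A ℓ} → Symmetric R → AllPairs R xs →
                  ∀ {i j} → i ≢ j → R (lookup xs i) (lookup xs j)
AllPairs-lookup R-sym (_ ∷ _)  {zero}  {zero}  i≢j = contradiction refl i≢j
AllPairs-lookup R-sym (r ∷ _)  {zero}  {suc j} i≢j = All.lookup r (∈-lookup j)
AllPairs-lookup R-sym (r ∷ _)  {suc i} {zero}  i≢j = R-sym (All.lookup r (∈-lookup i))
AllPairs-lookup R-sym (_ ∷ rs) {suc i} {suc j} i≢j =
  AllPairs-lookup R-sym rs (i≢j ∘ cong suc)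

-- The entry at position `n` serves as `y` and the `n` entries before it as `zs`. This yields a
-- common target, where the head of a list yields only a common source.
AllPairs-last : {R : Rel A ℓ} → AllPairs R xs → n < length xs →
                ∃[ y ] y ∈ˡ xs × (∃[ zs ] zs ⊆ xs × n ≤ length zs × All (λ z → R z y) zs)
AllPairs-last {n = zero} (_∷_ {x} {xs} _ _) _ = x , here refl , [] , minimum _ , z≤n , []
AllPairs-last {n = suc n} (r ∷ rs) (s≤s n<) =
  let y , y∈ , zs , τ , n≤ , rzs = AllPairs-last rs n<
  in y , there y∈ , _ ∷ zs , refl ∷ τ , s≤s n≤ , All.lookup r y∈ ∷ rzs

-- Pigeonhole: sending each position in `xs` to a position of the same element in `ys` is injective.
Unique-⊆-length : Unique xs → (∀ {x} → x ∈ˡ xs → x ∈ˡ ys) → length xs ≤ length ys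
Unique-⊆-length {xs = xs} {ys = ys} uniq xs⊆ys = injective⇒≤ position-injective
  where
  position : Fin (length xs) → Fin (length ys)
  position i = index (xs⊆ys (∈-lookup i))

  position-injective : Injective _≡_ _≡_ position
  position-injective {i} {j} eq = decidable-stable (i Fin.≟ j) λ i≢j →
    AllPairs-lookup ≢-sym uniq i≢j
      (trans (lookup-index (xs⊆ys (∈-lookup i)))
        (trans (cong (lookup ys) eq) (sym (lookup-index (xs⊆ys (∈-lookup j))))))

length-partition : ∀ {P : Pred A ℓ} (P? : ∀ x → Dec (P x)) xs →
                   length xs ≡ length (filter P? xs) + length (filter (¬? ∘ P?) xs)
length-partition P? []       = refl
length-partition P? (x ∷ xs) with P? x
... | yes _ = cong suc (length-partition P? xs)
... | no _  = trans (cong suc (length-partition P? xs)) (sym (ℕ.+-suc _ _))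

length-concatMap-≤ : (f : A → List B) → ∀ {b} → (∀ x → length (f x) ≤ b) →
                     ∀ xs → length (concatMap f xs) ≤ length xs * b
length-concatMap-≤ f f≤b []       = z≤n
length-concatMap-≤ f f≤b (x ∷ xs) =
  ≤-trans (≤-reflexive (length-++ (f x))) (+-mono-≤ (f≤b x) (length-concatMap-≤ f f≤b xs))

map-proj₁-toList : {P : Pred A ℓ} (pxs : All P xs) → map proj₁ (All.toList pxs) ≡ xs
map-proj₁-toList []         = refl
map-proj₁-toList (_ ∷ pxs) = cong (_ ∷_) (map-proj₁-toList pxs)

+-≤-split : ∀ m {n p q} → m + n ≤ p + q → m ≤ p ⊎ n ≤ q
+-≤-split m {n} {p} {q} m+n≤p+q with m ≤? p | n ≤? q
... | yes m≤p | _       = inj₁ m≤p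
... | no  _   | yes n≤q = inj₂ n≤q
... | no  m≰p | no  n≰q =
  contradiction m+n≤p+q (<⇒≱ (+-mono-< (≰⇒> m≰p) (≰⇒> n≰q)))

-- Ramsey's theorem on lists.

Homogeneous : Rel A ℓ → ℕ → List A → Set _
Homogeneous R k xs = ∃[ ys ] ys ⊆ xs × k ≤ length ys × AllPairs R ys

Homogeneous-resp-⊆ : {R : Rel A ℓ} → xs ⊆ ys → Homogeneous R n xs → Homogeneous R n ys
Homogeneous-resp-⊆ xs⊆ys (zs , τ , rest) = zs , ⊆-trans τ xs⊆ys , rest

Homogeneous-∷ : ∀ {R : Rel A ℓ} {x : A} → All (R x) ys → ys ⊆ xs →
                Homogeneous R n ys → Homogeneous R (suc n) (x ∷ xs)
Homogeneous-∷ r ys⊆xs (zs , τ , n≤ , rs) =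
  _ ∷ zs , refl ∷ ⊆-trans τ ys⊆xs , s≤s n≤ , All-resp-⊆ τ r ∷ rs

-- The Erdős-Szekeres recurrence, solved by binom(m + k, m) - 1; the `suc` accounts for the head of
-- the list.
ramseyNumber : ℕ → ℕ → ℕ
ramseyNumber zero    _       = 0
ramseyNumber (suc m) zero    = 0
ramseyNumber (suc m) (suc k) = suc (ramseyNumber m (suc k) + ramseyNumber (suc m) k)

-- The relation need not be symmetric: the colour of a pair is read off in list order.
ramsey : {R : Rel A ℓ} (R? : Decidable R) → ∀ m k xs → ramseyNumber m k ≤ length xs →
         Homogeneous R m xs ⊎ Homogeneous (λ x y → ¬ R x y) k xs
ramsey R? zero    k       xs       _ = inj₁ ([] , minimum _ , z≤n , [])
ramsey R? (suc m) zero    xs       _ = inj₂ ([] , minimum _ , z≤n , [])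
ramsey R? (suc m) (suc k) (x ∷ xs) (s≤s N≤)
  with +-≤-split (ramseyNumber m (suc k))
         (≤-trans N≤ (≤-reflexive (length-partition (R? x) xs)))
... | inj₁ N≤related = Sum.map
  (Homogeneous-∷ (all-filter (R? x) xs) (filter-⊆ (R? x) xs))
  (Homogeneous-resp-⊆ (x ∷ʳ filter-⊆ (R? x) xs))
  (ramsey R? m (suc k) (filter (R? x) xs) N≤related)
... | inj₂ N≤unrelated = Sum.map
  (Homogeneous-resp-⊆ (x ∷ʳ filter-⊆ (¬? ∘ R? x) xs))
  (Homogeneous-∷ (all-filter (¬? ∘ R? x) xs) (filter-⊆ (¬? ∘ R? x) xs))
  (ramsey R? (suc m) k (filter (¬? ∘ R? x) xs) N≤unrelated)

-- With one colour excluded, Ramsey's theorem thins out a list until no pair is related. Each use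
-- below removes one kind of adjacency between legs.
ramsey-avoiding : {R : Rel A ℓ} (R? : Decidable R) → ∀ m {k xs} →
                  (∀ {ys} → ys ⊆ xs → AllPairs R ys → ¬ m ≤ length ys) →
                  ramseyNumber m k ≤ length xs → Homogeneous (λ x y → ¬ R x y) k xs
ramsey-avoiding R? m avoids N≤ with ramsey R? m _ _ N≤
... | inj₁ (ys , ys⊆xs , m≤ , rs) = contradiction m≤ (avoids ys⊆xs rs)
... | inj₂ homogeneous            = homogeneous

-- Branching vertices of a graph.

ballBound : ℕ → ℕ → ℕ
ballBound m zero    = 1
ballBound m (suc r) = suc (m * ballBound m r)

module GraphProperties (G : Graph) where
  open Graph G public

  infix 4 _≟_

  _≟_ : DecidableEquality Vertex
  u ≟ v = map′ from-injective (cong from) (from u Fin.≟ from v)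
    where
    open Inverse enum
    from-injective : from u ≡ from v → u ≡ v
    from-injective eq = trans (sym (strictlyInverseˡ u)) (trans (cong to eq) (strictlyInverseˡ v))

  ∈-vertices : ∀ v → v ∈ˡ vertices
  ∈-vertices v = subst (_∈ˡ vertices) (strictlyInverseˡ v) (∈-map⁺ to (∈-allFin (from v)))
    where open Inverse enum

  vertices-unique : Unique vertices
  vertices-unique = Unique.map⁺ to-injective (Unique.allFin⁺ order)
    where
    open Inverse enum
    to-injective : Injective _≡_ _≡_ to
    to-injective {i} {j} eq =
      trans (sym (strictlyInverseʳ i)) (trans (cong from eq) (strictlyInverseʳ j))

  Branching : Pred Vertex 0ℓ
  Branching v = 2 ≤ degree v

  branching? : ∀ v → Dec (Branching v)
  branching? v = 2 ≤? degree v

  neighbours⇒branching : ∀ u v w → v ~ u → v ~ w → u ≢ w → Branching v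
  neighbours⇒branching u v w v~u v~w u≢w =
    Unique-⊆-length {xs = u ∷ w ∷ []} ((u≢w ∷ []) ∷ [] ∷ []) λ where
      (here refl)         → ∈-filter⁺ (v ~?_) (∈-vertices u) v~u
      (there (here refl)) → ∈-filter⁺ (v ~?_) (∈-vertices w) v~w

  otherNeighbour : ∀ {u} v → Branching u → ∃[ w ] u ~ w × v ≢ w
  otherNeighbour {u} v br
    with filter (u ~?_) vertices | all-filter (u ~?_) vertices
       | Unique.filter⁺ (u ~?_) vertices-unique | br
  ... | _ ∷ []    | _              | _                  | s≤s ()
  ... | x ∷ y ∷ _ | u~x ∷ u~y ∷ _  | (x≢y ∷ _) ∷ _      | _ with v ≟ x
  ...   | yes refl = y , u~y , x≢y
  ...   | no v≢x   = x , u~x , v≢x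

  injection⇒≤#degree≥2 : (f : Fin n → Vertex) → Injective _≡_ _≡_ f → (∀ i → Branching (f i)) →
                         n ≤ #degree≥2
  injection⇒≤#degree≥2 f f-inj br =
    ≤-trans (≤-reflexive (sym (length-tabulate f)))
      (Unique-⊆-length (Unique.tabulate⁺ f-inj) λ x∈ → case ∈-tabulate⁻ x∈ of λ where
        (i , refl) → ∈-filter⁺ branching? (∈-vertices (f i)) (br i))

  hub⇒connected : ∀ c → (∀ v → Star _~_ v c) → Connected G
  hub⇒connected c toHub u v = toHub u ◅◅ reverse ~-sym (toHub v)

  -- Apartness and induced paths.

  Touches : Rel Vertex 0ℓ
  Touches u v = u ≡ v ⊎ u ~ v

  touches? : Decidable Touches
  touches? u v = (u ≟ v) ⊎-dec (u ~? v)

  -- Distinctness is included, so that a map preserving adjacency and apartness is an induced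
  -- embedding.
  Apart : Rel Vertex 0ℓ
  Apart u v = ¬ Touches u v

  apart-sym : Symmetric Apart
  apart-sym u#v = u#v ∘ Sum.map sym ~-sym

  -- The list leaves out the start and ends with the last vertex, so its length counts edges.
  data InducedPath : Vertex → List Vertex → Vertex → Set where
    []  : ∀ {v} → InducedPath v [] v
    _∷_ : ∀ {u x xs v} → u ~ x × All (Apart u) xs → InducedPath x xs v → InducedPath u (x ∷ xs) v

  -- Join u to the last vertex of the path that it touches.
  extend : ∀ {u x xs v} → InducedPath x xs v → Any (Touches u) (x ∷ xs) → ∃[ ys ] InducedPath u ys v
  extend [] (here (inj₁ refl)) = [] , []
  extend [] (here (inj₂ u~x))  = _ , (u~x , []) ∷ []
  extend {u} {xs = xs} (e ∷ p) t with any? (touches? u) xs | t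
  ... | yes t′ | _                = extend p t′
  ... | no ¬t′ | here (inj₁ refl) = _ , e ∷ p
  ... | no ¬t′ | here (inj₂ u~x)  = _ , (u~x , ¬Any⇒All¬ xs ¬t′) ∷ e ∷ p
  ... | no ¬t′ | there t′         = contradiction t′ ¬t′

  -- The walk is processed from its far end; attaching each vertex by a shortcut keeps the path
  -- induced.
  inducedPath : ∀ {u v} → Star _~_ u v → ∃[ xs ] InducedPath u xs v
  inducedPath ε            = [] , []
  inducedPath (u~x ◅ rest) = extend (proj₂ (inducedPath rest)) (here (inj₂ u~x))

  path-edge : ∀ {u xs v} → InducedPath u xs v → ∀ i j → suc (toℕ i) ≡ toℕ j →
              lookup (u ∷ xs) i ~ lookup (u ∷ xs) j
  path-edge ((u~x , _) ∷ _) zero    1F      _  = u~x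
  path-edge (_ ∷ p)         (suc i) (suc j) eq = path-edge p i j (suc-injective eq)

  path-apart : ∀ {u xs v} → InducedPath u xs v → ∀ i j → suc (toℕ i) < toℕ j →
               Apart (lookup (u ∷ xs) i) (lookup (u ∷ xs) j)
  path-apart ((_ , u#) ∷ _) zero    (suc (suc j)) _        = All.lookup u# (∈-lookup j)
  path-apart (_ ∷ p)        zero    1F            (s≤s ())
  path-apart (_ ∷ p)        (suc i) (suc j)       (s≤s lt) = path-apart p i j lt

  -- An inner vertex is adjacent to its predecessor and its successor, which differ because they are
  -- apart.
  path-branching : ∀ {u xs v} → InducedPath u xs v → Branching u → Branching v →
                   All Branching xs
  path-branching []                _   _   = []
  path-branching (_ ∷ [])          _   v-br = v-br ∷ []
  path-branching ((u~x , u# ∷ _) ∷ p@((x~y , _) ∷ _)) u-br v-br =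
    x-br ∷ path-branching p x-br v-br
    where x-br = neighbours⇒branching _ _ _ (~-sym u~x) x~y (u# ∘ inj₁)

  -- Balls of branching vertices, and legs at a vertex.

  branchingNeighbours : Vertex → List Vertex
  branchingNeighbours v = filter (λ u → (v ~? u) ×-dec branching? u) vertices

  -- Collects the ends of walks of at most `r` steps from `s`, each step entering a branching
  -- vertex. Repetitions are harmless, as only an upper bound on the length is wanted.
  ball : ℕ → Vertex → List Vertex
  ball zero    s = [ s ]
  ball (suc r) s = s ∷ concatMap (ball r) (branchingNeighbours s)

  centre∈ball : ∀ r {s} → s ∈ˡ ball r s
  centre∈ball zero    = here refl
  centre∈ball (suc r) = here refl

  path⇒∈ball : ∀ r {s xs t} → InducedPath s xs t → All Branching xs → length xs ≤ r →
               t ∈ˡ ball r s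
  path⇒∈ball r       []                []           _        = centre∈ball r
  path⇒∈ball (suc r) ((s~x , _) ∷ p)   (x-br ∷ br) (s≤s len) =
    there (∈-concatMap⁺ (ball r) (lose
      (∈-filter⁺ (λ u → (_ ~? u) ×-dec branching? u) (∈-vertices _) (s~x , x-br))
      (path⇒∈ball r p br len)))

  -- The bound `ballBound m r` is the geometric sum 1 + m + ... + m^r.
  length-ball : ∀ {m} → (∀ v → length (branchingNeighbours v) ≤ m) →
                ∀ r s → length (ball r s) ≤ ballBound m r
  length-ball few zero    s = ≤-refl
  length-ball few (suc r) s = s≤s (≤-trans
    (length-concatMap-≤ (ball r) (length-ball few r) (branchingNeighbours s))
    (*-monoˡ-≤ _ (few s)))

  -- A path v - mid - end; the vertices v and end may be adjacent.
  record LegAt (v mid : Vertex) : Set where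
    field
      end     : Vertex
      v~mid   : v ~ mid
      mid~end : mid ~ end
      v≢end   : v ≢ end

  Leg : Vertex → Set
  Leg v = ∃[ mid ] LegAt v mid

  mid : ∀ {v} → Leg v → Vertex
  mid = proj₁

  module _ {v : Vertex} (leg : Leg v) where
    open LegAt (proj₂ leg) public

  -- A branching neighbour of `v` has a neighbour other than `v` to serve as end. Since the mids
  -- form exactly the list of branching neighbours, its length and distinctness carry over to the
  -- legs.
  legs : ∀ v → Σ[ ps ∈ List (Leg v) ] map mid ps ≡ branchingNeighbours v
  legs v = All.toList legsAt , map-proj₁-toList legsAt
    where
    legsAt : All (LegAt v) (branchingNeighbours v)
    legsAt = All.map
      (λ (v~u , u-br) → let w , u~w , v≢w = otherNeighbour v u-br in
        record { end = w ; v~mid = v~u ; mid~end = u~w ; v≢end = v≢w })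
      (all-filter (λ u → (v ~? u) ×-dec branching? u) vertices)

  Independent : ∀ {v} → Rel (Leg v) 0ℓ
  Independent = Apart on mid

  Spread : ∀ {v} → Rel (Leg v) 0ℓ
  Spread p q = Apart (mid p) (mid q) × Apart (end p) (end q) ×
               Apart (mid p) (end q) × Apart (end p) (mid q)

  -- Given independent mids, non-adjacency suffices: if two vertices of different legs coincided,
  -- the edge from mid to end of one leg would be a forbidden edge between the legs.
  spread : ∀ {v} {p q : Leg v} → Independent p q → ¬ end p ~ end q →
           ¬ end p ~ mid q → ¬ end q ~ mid p → Spread p q
  spread {p = p} {q} p#q e≁e e≁m m≁e =
    p#q ,
    [ (λ e≡e → e≁m (subst (_~ mid q) (sym e≡e) (~-sym (mid~end q)))) , e≁e ]′ ,
    [ (λ m≡e → p#q (inj₂ (subst (_~ mid q) (sym m≡e) (~-sym (mid~end q))))) , m≁e ∘ ~-sym ]′ ,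
    [ (λ e≡m → p#q (inj₂ (subst (mid p ~_) e≡m (mid~end p)))) , e≁m ]′

  spread-sym : ∀ {v} {p q : Leg v} → Spread p q → Spread q p
  spread-sym (mm , ee , me , em) = apart-sym mm , apart-sym ee , apart-sym em , apart-sym me

-- Induced embeddings, and the bound from few branching neighbours.

≤ᴳ-trans : ∀ {F G H} → F ≤ᴳ G → G ≤ᴳ H → F ≤ᴳ H
≤ᴳ-trans (f , f-inj , f-iff) (g , g-inj , g-iff) =
  g ∘ f , f-inj ∘ g-inj , λ u v → mk⇔
    (Equivalence.to (g-iff (f u) (f v)) ∘ Equivalence.to (f-iff u v))
    (Equivalence.from (f-iff u v) ∘ Equivalence.from (g-iff (f u) (f v)))

module _ {G : Graph} where
  open GraphProperties G

  -- Any two vertices are equal, adjacent or apart, and these cases exclude one another. So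
  -- preserving the last two gives injectivity and reflection of edges.
  embed : ∀ H → let module H = GraphProperties H in
          (f : H.Vertex → Vertex) →
          (∀ u v → u H.~ v → f u ~ f v) →
          (∀ u v → H.Apart u v → Apart (f u) (f v)) →
          H ≤ᴳ G
  embed H f edge apart = f , f-inj _ _ , λ u v → mk⇔ (edge u v) (edge⁻ u v)
    where
    module H = GraphProperties H

    f-inj : ∀ u v → f u ≡ f v → u ≡ v
    f-inj u v fu≡fv with H.touches? u v
    ... | yes (inj₁ u≡v) = u≡v
    ... | yes (inj₂ u~v) = contradiction (edge u v u~v) (~-irrefl fu≡fv)
    ... | no u#v         = contradiction (inj₁ fu≡fv) (apart u v u#v)

    edge⁻ : ∀ u v → f u ~ f v → u H.~ v
    edge⁻ u v fu~fv with H.touches? u v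
    ... | yes (inj₁ u≡v) = contradiction fu~fv (~-irrefl (cong f u≡v))
    ... | yes (inj₂ u~v) = u~v
    ... | no u#v         = contradiction (inj₂ fu~fv) (apart u v u#v)

  path⇒P : ∀ {u xs v} → InducedPath u xs v → n ≤ suc (length xs) → P n ≤ᴳ G
  path⇒P {n = n} {u} {xs} p n≤ = embed (P n) (lookup (u ∷ xs) ∘ ι) edge apart
    where
    module Pₙ = GraphProperties (P n)

    ι : Fin n → Fin (suc (length xs))
    ι i = inject≤ i n≤

    toℕ-ι : ∀ i → toℕ (ι i) ≡ toℕ i
    toℕ-ι i = toℕ-inject≤ i n≤

    edge : ∀ i j → i Pₙ.~ j → lookup (u ∷ xs) (ι i) ~ lookup (u ∷ xs) (ι j)
    edge i j (inj₁ eq) =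
      path-edge p _ _ (trans (cong suc (toℕ-ι i)) (trans eq (sym (toℕ-ι j))))
    edge i j (inj₂ eq) =
      ~-sym (path-edge p _ _ (trans (cong suc (toℕ-ι j)) (trans eq (sym (toℕ-ι i)))))

    apart-< : ∀ i j → toℕ i < toℕ j → Pₙ.Apart i j →
              Apart (lookup (u ∷ xs) (ι i)) (lookup (u ∷ xs) (ι j))
    apart-< i j i<j i#j = path-apart p _ _
      (subst₂ (λ k l → suc k < l) (sym (toℕ-ι i)) (sym (toℕ-ι j))
        (ℕ.≤∧≢⇒< i<j (i#j ∘ inj₂ ∘ inj₁)))

    apart : ∀ i j → Pₙ.Apart i j → Apart (lookup (u ∷ xs) (ι i)) (lookup (u ∷ xs) (ι j))
    apart i j i#j with <-cmp (toℕ i) (toℕ j)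
    ... | tri< i<j _ _ = apart-< i j i<j i#j
    ... | tri≈ _ i≡j _ = contradiction (inj₁ (toℕ-injective i≡j)) i#j
    ... | tri> _ _ j<i = apart-sym (apart-< j i j<i (Pₙ.apart-sym {i} {j} i#j))

  -- Without an induced `P n`, induced paths between branching vertices have at most `n` edges, so
  -- one ball of radius `n` contains all branching vertices.
  #degree≥2-bounded : ∀ {m} → Connected G → ¬ (P n ≤ᴳ G) →
                      (∀ v → length (branchingNeighbours v) ≤ m) →
                      #degree≥2 ≤ ballBound m n
  #degree≥2-bounded {n = n} {m} conn noP few = bound (filter branching? vertices) refl
    where
    -- Matching on a list kept equal to that of the branching vertices provides the centre `s`.
    bound : ∀ xs → xs ≡ filter branching? vertices → length xs ≤ ballBound m n
    bound []       _  = z≤n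
    bound xs@(s ∷ _) eq = ≤-trans
      (Unique-⊆-length (subst Unique (sym eq) (Unique.filter⁺ branching? vertices-unique)) in-ball)
      (length-ball few n s)
      where
      isBranching : ∀ {t} → t ∈ˡ xs → Branching t
      isBranching t∈ = proj₂ (∈-filter⁻ branching? {xs = vertices} (subst (_ ∈ˡ_) eq t∈))

      in-ball : ∀ {t} → t ∈ˡ xs → t ∈ˡ ball n s
      in-ball {t} t∈ =
        let ys , p = inducedPath (conn s t) in
        path⇒∈ball n p (path-branching p (isBranching (here refl)) (isBranching t∈))
          (≮⇒≥ λ n<len → noP (path⇒P p (≤-trans (<⇒≤ n<len) (ℕ.n≤1+n _))))

  -- Cliques, pairs of hubs and spread legs as sources of induced subgraphs.

  clique⇒K : ∀ {xs} → AllPairs _~_ xs → n ≤ length xs → K n ≤ᴳ G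
  clique⇒K {n = n} {xs} clique n≤ = embed (K n) (λ i → lookup xs (inject≤ i n≤))
    (λ i j i≢j → AllPairs-lookup ~-sym clique (i≢j ∘ inject≤-injective n≤ n≤ i j))
    (λ i j i#j → contradiction (decidable-stable (i Fin.≟ j) (i#j ∘ inj₂)) (i#j ∘ inj₁))

  module _ {v w : Vertex} (v≢w : v ≢ w) (u : Fin n → Vertex)
           (v~u : ∀ i → v ~ u i) (w~u : ∀ i → w ~ u i)
           (u-apart : ∀ {i j} → i ≢ j → Apart (u i) (u j)) where

    private
      hub : Fin 2 → Vertex
      hub 0F = v
      hub 1F = w

      hub~u : ∀ h i → hub h ~ u i
      hub~u 0F = v~u
      hub~u 1F = w~u

    nonadjacentHubs⇒K₂ₙ : ¬ v ~ w → K[ 2 , n ] ≤ᴳ G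
    nonadjacentHubs⇒K₂ₙ v≁w = embed H f edge apart
      where
      H = K[ 2 , n ]
      module H = GraphProperties H

      f : H.Vertex → Vertex
      f (inj₁ h) = hub h
      f (inj₂ i) = u i

      edge : ∀ x y → x H.~ y → f x ~ f y
      edge (inj₁ h) (inj₂ i) _ = hub~u h i
      edge (inj₂ i) (inj₁ h) _ = ~-sym (hub~u h i)

      apart : ∀ x y → H.Apart x y → Apart (f x) (f y)
      apart (inj₁ 0F) (inj₁ 0F) x#y = contradiction (inj₁ refl) x#y
      apart (inj₁ 0F) (inj₁ 1F) _   = [ v≢w , v≁w ]′
      apart (inj₁ 1F) (inj₁ 0F) _   = [ v≢w ∘ sym , v≁w ∘ ~-sym ]′
      apart (inj₁ 1F) (inj₁ 1F) x#y = contradiction (inj₁ refl) x#y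
      apart (inj₁ _)  (inj₂ _)  x#y = contradiction (inj₂ tt) x#y
      apart (inj₂ _)  (inj₁ _)  x#y = contradiction (inj₂ tt) x#y
      apart (inj₂ i)  (inj₂ j)  x#y = u-apart (x#y ∘ inj₁ ∘ cong inj₂)

    adjacentHubs⇒K₂+nK₁ : v ~ w → K 2 +ᴳ n · K 1 ≤ᴳ G
    adjacentHubs⇒K₂+nK₁ v~w = embed H f edge apart
      where
      H = K 2 +ᴳ n · K 1
      module H = GraphProperties H

      f : H.Vertex → Vertex
      f (inj₁ h)       = hub h
      f (inj₂ (i , _)) = u i

      edge : ∀ x y → x H.~ y → f x ~ f y
      edge (inj₁ 0F)       (inj₁ 0F)       x≢y       = contradiction refl x≢y
      edge (inj₁ 0F)       (inj₁ 1F)       _         = v~w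
      edge (inj₁ 1F)       (inj₁ 0F)       _         = ~-sym v~w
      edge (inj₁ 1F)       (inj₁ 1F)       x≢y       = contradiction refl x≢y
      edge (inj₁ h)        (inj₂ (i , _))  _         = hub~u h i
      edge (inj₂ (i , _))  (inj₁ h)        _         = ~-sym (hub~u h i)
      edge (inj₂ (_ , 0F)) (inj₂ (_ , 0F)) (_ , x≢y) = contradiction refl x≢y

      apart : ∀ x y → H.Apart x y → Apart (f x) (f y)
      apart (inj₁ h)        (inj₁ h′)       x#y =
        contradiction (decidable-stable (h Fin.≟ h′) (x#y ∘ inj₂)) (x#y ∘ inj₁ ∘ cong inj₁)
      apart (inj₁ _)        (inj₂ _)        x#y = contradiction (inj₂ tt) x#y
      apart (inj₂ _)        (inj₁ _)        x#y = contradiction (inj₂ tt) x#y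
      apart (inj₂ (i , 0F)) (inj₂ (j , 0F)) x#y =
        u-apart (x#y ∘ inj₁ ∘ cong (λ k → inj₂ (k , 0F)))

  module _ {v : Vertex} (leg : Fin n → Leg v)
           (spread : ∀ {i j} → i ≢ j → Spread (leg i) (leg j)) where

    openLegs⇒K*₁ₙ : (∀ i → ¬ v ~ end (leg i)) → K*[1, n ] ≤ᴳ G
    openLegs⇒K*₁ₙ v≁end = embed H f edge apart
      where
      H = K*[1, n ]
      module H = GraphProperties H

      f : H.Vertex → Vertex
      f (inj₁ (inj₁ _)) = v
      f (inj₁ (inj₂ i)) = mid (leg i)
      f (inj₂ i)        = end (leg i)

      edge : ∀ x y → x H.~ y → f x ~ f y
      edge (inj₁ (inj₁ _)) (inj₁ (inj₂ i)) _    = v~mid (leg i)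
      edge (inj₁ (inj₂ i)) (inj₁ (inj₁ _)) _    = ~-sym (v~mid (leg i))
      edge (inj₁ (inj₂ i)) (inj₂ j)        refl = mid~end (leg i)
      edge (inj₂ i)        (inj₁ (inj₂ j)) refl = ~-sym (mid~end (leg i))

      v#end : ∀ i → Apart v (end (leg i))
      v#end i = [ v≢end (leg i) , v≁end i ]′

      apart : ∀ x y → H.Apart x y → Apart (f x) (f y)
      apart (inj₁ (inj₁ 0F)) (inj₁ (inj₁ 0F)) x#y = contradiction (inj₁ refl) x#y
      apart (inj₁ (inj₁ _))  (inj₁ (inj₂ _))  x#y = contradiction (inj₂ tt) x#y
      apart (inj₁ (inj₁ _))  (inj₂ i)         _   = v#end i
      apart (inj₁ (inj₂ _))  (inj₁ (inj₁ _))  x#y = contradiction (inj₂ tt) x#y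
      apart (inj₁ (inj₂ i))  (inj₁ (inj₂ j))  x#y =
        proj₁ (spread (x#y ∘ inj₁ ∘ cong (inj₁ ∘ inj₂)))
      apart (inj₁ (inj₂ i))  (inj₂ j)         x#y = proj₁ (proj₂ (proj₂ (spread (x#y ∘ inj₂))))
      apart (inj₂ i)         (inj₁ (inj₁ _))  _   = apart-sym (v#end i)
      apart (inj₂ i)         (inj₁ (inj₂ j))  x#y = proj₂ (proj₂ (proj₂ (spread (x#y ∘ inj₂))))
      apart (inj₂ i)         (inj₂ j)         x#y =
        proj₁ (proj₂ (spread (x#y ∘ inj₁ ∘ cong inj₂)))

    closedLegs⇒K₁+nK₂ : (∀ i → v ~ end (leg i)) → K 1 +ᴳ n · K 2 ≤ᴳ G
    closedLegs⇒K₁+nK₂ v~end = embed H f edge apart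
      where
      H = K 1 +ᴳ n · K 2
      module H = GraphProperties H

      side : Leg v → Fin 2 → Vertex
      side p 0F = mid p
      side p 1F = end p

      f : H.Vertex → Vertex
      f (inj₁ _)       = v
      f (inj₂ (i , s)) = side (leg i) s

      v~side : ∀ i s → v ~ side (leg i) s
      v~side i 0F = v~mid (leg i)
      v~side i 1F = v~end i

      side-apart : ∀ {p q} → Spread p q → ∀ s t → Apart (side p s) (side q t)
      side-apart (mm , ee , me , em) 0F 0F = mm
      side-apart (mm , ee , me , em) 0F 1F = me
      side-apart (mm , ee , me , em) 1F 0F = em
      side-apart (mm , ee , me , em) 1F 1F = ee

      edge : ∀ x y → x H.~ y → f x ~ f y
      edge (inj₁ 0F)       (inj₁ 0F)        x≢y          = contradiction refl x≢y
      edge (inj₁ _)        (inj₂ (i , s))   _            = v~side i s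
      edge (inj₂ (i , s))  (inj₁ _)         _            = ~-sym (v~side i s)
      edge (inj₂ (i , 0F)) (inj₂ (.i , 0F)) (refl , s≢t) = contradiction refl s≢t
      edge (inj₂ (i , 0F)) (inj₂ (.i , 1F)) (refl , _)   = mid~end (leg i)
      edge (inj₂ (i , 1F)) (inj₂ (.i , 0F)) (refl , _)   = ~-sym (mid~end (leg i))
      edge (inj₂ (i , 1F)) (inj₂ (.i , 1F)) (refl , s≢t) = contradiction refl s≢t

      apart : ∀ x y → H.Apart x y → Apart (f x) (f y)
      apart (inj₁ 0F)      (inj₁ 0F)      x#y = contradiction (inj₁ refl) x#y
      apart (inj₁ _)       (inj₂ _)       x#y = contradiction (inj₂ tt) x#y
      apart (inj₂ _)       (inj₁ _)       x#y = contradiction (inj₂ tt) x#y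
      apart (inj₂ (i , s)) (inj₂ (j , t)) x#y with i Fin.≟ j
      -- Different copies of `K 2` come from different legs; inside one copy no two vertices are
      -- apart.
      ... | no i≢j   = side-apart (spread i≢j) s t
      ... | yes refl = contradiction
        (decidable-stable (s Fin.≟ t) λ s≢t → x#y (inj₂ (refl , s≢t)))
        (x#y ∘ inj₁ ∘ cong (λ r → inj₂ (i , r)))

-- Bounding the legs at a vertex by repeated use of Ramsey's theorem.

unavoidable : ℕ → List Graph
unavoidable n = K n ∷ P n ∷ K*[1, n ] ∷ K[ 2 , n ] ∷ K 2 +ᴳ n · K 1 ∷ K 1 +ᴳ n · K 2 ∷ []

-- From the inside out: ends pairwise non-adjacent, no later end adjacent to an
-- earlier mid, no earlier end adjacent to a later mid, mids pairwise non-adjacent.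
legBound : ℕ → ℕ
legBound n =
  ramseyNumber n (ramseyNumber (suc n) (ramseyNumber (suc n) (ramseyNumber n (n + n))))

module _ {G : Graph} (avoids : ∀ {F} → F ∈ˡ unavoidable n → ¬ F ≤ᴳ G) where
  open GraphProperties G

  noClique : ∀ {xs} → AllPairs _~_ xs → ¬ n ≤ length xs
  noClique clique n≤ = avoids (here refl) (clique⇒K {G = G} clique n≤)

  module _ {v : Vertex} where

    -- The vertices `v` and `w` are two hubs over the mids, which are pairwise apart. Whether the
    -- hubs are adjacent decides which forbidden graph appears.
    noCommonNeighbours : ∀ {w} {ps : List (Leg v)} → v ≢ w → AllPairs Independent ps →
                         All (λ p → w ~ mid p) ps → ¬ n ≤ length ps
    noCommonNeighbours {w} {ps} v≢w indep w~mid n≤ with v ~? w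
    ... | no  v≁w = avoids (there (there (there (here refl))))
      (nonadjacentHubs⇒K₂ₙ {G = G} v≢w _ (λ i → v~mid (lookup ps (inject≤ i n≤)))
        (λ i → All.lookup w~mid (∈-lookup (inject≤ i n≤)))
        (λ i≢j → AllPairs-lookup apart-sym indep (i≢j ∘ inject≤-injective n≤ n≤ _ _)) v≁w)
    ... | yes v~w = avoids (there (there (there (there (here refl)))))
      (adjacentHubs⇒K₂+nK₁ {G = G} v≢w _ (λ i → v~mid (lookup ps (inject≤ i n≤)))
        (λ i → All.lookup w~mid (∈-lookup (inject≤ i n≤)))
        (λ i≢j → AllPairs-lookup apart-sym indep (i≢j ∘ inject≤-injective n≤ n≤ _ _)) v~w)

    -- Among `n + n` legs, at least `n` have ends adjacent to `v` or at least `n` have ends not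
    -- adjacent to `v`.
    noSpreadLegs : {ps : List (Leg v)} → AllPairs Spread ps → ¬ n + n ≤ length ps
    noSpreadLegs {ps} spread n+n≤ with +-≤-split n
      (≤-trans n+n≤ (≤-reflexive (length-partition (λ p → v ~? end p) ps)))
    ... | inj₁ n≤closed = avoids (there (there (there (there (there (here refl))))))
      (closedLegs⇒K₁+nK₂ {G = G} (λ i → lookup closed (inject≤ i n≤closed))
        (λ i≢j → AllPairs-lookup (λ {p} {q} → spread-sym {p = p} {q}) (AllPairs.filter⁺ _ spread)
          (i≢j ∘ inject≤-injective n≤closed n≤closed _ _))
        (λ i → All.lookup (all-filter _ ps) (∈-lookup {xs = closed} (inject≤ i n≤closed))))
      where closed = filter (λ p → v ~? end p) ps
    ... | inj₂ n≤open = avoids (there (there (here refl)))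
      (openLegs⇒K*₁ₙ {G = G} (λ i → lookup opened (inject≤ i n≤open))
        (λ i≢j → AllPairs-lookup (λ {p} {q} → spread-sym {p = p} {q}) (AllPairs.filter⁺ _ spread)
          (i≢j ∘ inject≤-injective n≤open n≤open _ _))
        (λ i → All.lookup (all-filter _ ps) (∈-lookup {xs = opened} (inject≤ i n≤open))))
      where opened = filter (λ p → ¬? (v ~? end p)) ps

    legs-bounded : {ps : List (Leg v)} → Unique (map mid ps) → ¬ legBound n ≤ length ps
    legs-bounded {ps} uniq N₀≤ =
      let qs , qs⊆ps , N₁≤ , mid≁mid = ramsey-avoiding mid~mid? n
            (λ {ys} _ clique → noClique (AllPairs.map⁺ clique) ∘ subst (n ≤_) (sym (length-map mid ys)))
            N₀≤
          indep = AllPairs.zipWith (λ (p≢q , p≁q) → [ p≢q , p≁q ]′)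
            (AllPairs-resp-⊆ qs⊆ps (AllPairs.map⁻ uniq) , mid≁mid)
          -- If each end is adjacent to all later mids, the first end is a second hub over the mids
          -- of the other legs. One leg beyond `n` is spent on the hub, hence `suc n`.
          rs , rs⊆qs , N₂≤ , end≁mid = ramsey-avoiding end~mid? (suc n)
            (λ ys⊆qs → λ { (_∷_ {p} p~ _) (s≤s n≤) → noCommonNeighbours (v≢end p)
              (AllPairs.tail (AllPairs-resp-⊆ ys⊆qs indep)) p~ n≤ })
            N₁≤
          indep = AllPairs-resp-⊆ rs⊆qs indep
          -- The flipped relation makes an end adjacent to all earlier mids, so the hub comes from a
          -- leg preceded by `n` others.
          ss , ss⊆rs , N₃≤ , mid≁end = ramsey-avoiding (flip end~mid?) (suc n)
            (λ ys⊆rs cross n< → let p , _ , zs , zs⊆ys , n≤ , ~p = AllPairs-last cross n< in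
              noCommonNeighbours (v≢end p)
                (AllPairs-resp-⊆ (⊆-trans zs⊆ys ys⊆rs) indep) ~p n≤)
            N₂≤
          ts , ts⊆ss , N₄≤ , end≁end = ramsey-avoiding end~end? n
            (λ {ys} _ clique → noClique (AllPairs.map⁺ clique) ∘ subst (n ≤_) (sym (length-map end ys)))
            N₃≤
          ts⊆rs = ⊆-trans ts⊆ss ss⊆rs
      in noSpreadLegs
        (AllPairs.zipWith (λ {p} {q} ((p#q , e≁e) , (e≁m , m≁e)) → spread {p = p} {q} p#q e≁e e≁m m≁e)
          ( AllPairs.zip (AllPairs-resp-⊆ ts⊆rs indep , end≁end)
          , AllPairs.zip (AllPairs-resp-⊆ ts⊆rs end≁mid , AllPairs-resp-⊆ ts⊆ss mid≁end)))
        N₄≤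
      where
      mid~mid? end~mid? end~end? : Decidable {A = Leg v} _
      mid~mid? p q = mid p ~? mid q
      end~mid? p q = end p ~? mid q
      end~end? p q = end p ~? end q

  -- More than `legBound n` branching neighbours of one vertex would give as many legs with distinct
  -- mids.
  #degree≥2-bounded-by-avoiding : Connected G → #degree≥2 ≤ ballBound (legBound n) n
  #degree≥2-bounded-by-avoiding conn =
    #degree≥2-bounded {G = G} conn (avoids (there (here refl))) λ v → ≮⇒≥ λ N< →
      let ps , mids≡ = legs v in
      legs-bounded {v} (subst Unique (sym mids≡) (Unique.filter⁺ _ vertices-unique))
        (≤-trans (<⇒≤ N<) (≤-reflexive (trans (cong length (sym mids≡)) (length-map mid ps))))

-- The six graphs have many branching vertices.

Exceeds : ℕ → Pred Graph _
Exceeds C G = Connected G × C < Graph.#degree≥2 G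

K-exceeds : ∀ C → Exceeds C (K (3 + C))
K-exceeds C = hub⇒connected 0F toHub ,
  -- The vertices `0F` and `1F` serve as common neighbours of the `1 + C` counted ones, whence the
  -- 3.
  injection⇒≤#degree≥2 (λ i → suc (suc i)) (Fin.suc-injective ∘ Fin.suc-injective)
    (λ i → neighbours⇒branching 0F (suc (suc i)) 1F (λ ()) (λ ()) (λ ()))
  where
  open GraphProperties (K (3 + C))
  toHub : ∀ v → Star _~_ v 0F
  toHub zero    = ε
  toHub (suc v) = (λ ()) ◅ ε

P-exceeds : ∀ C → Exceeds C (P (3 + C))
P-exceeds C = hub⇒connected 0F
    (<-weakInduction (λ v → Star _~_ v 0F) ε λ i rest → inj₂ (cong suc (toℕ-inject₁ i)) ◅ rest) ,
  -- Counted are the `1 + C` inner vertices; the two ends of the path have degree 1.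
  injection⇒≤#degree≥2 (λ i → suc (inject₁ i)) (Fin.inject₁-injective ∘ Fin.suc-injective)
    (λ i → neighbours⇒branching (inject₁ (inject₁ i)) (suc (inject₁ i)) (suc (suc i))
      (inj₂ (cong suc (toℕ-inject₁ (inject₁ i))))
      (inj₁ (cong (λ k → suc (suc k)) (toℕ-inject₁ i)))
      (λ eq → <⇒≢ (ℕ.m≤n⇒m≤1+n ≤-refl)
        (trans (sym (trans (toℕ-inject₁ (inject₁ i)) (toℕ-inject₁ i))) (cong toℕ eq))))
  where open GraphProperties (P (3 + C))

K*-exceeds : ∀ n → Exceeds n K*[1, suc n ]
K*-exceeds n = hub⇒connected (inj₁ (inj₁ 0F)) toHub ,
  injection⇒≤#degree≥2 (λ i → inj₁ (inj₂ i)) (λ { refl → refl })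
    (λ i → neighbours⇒branching (inj₁ (inj₁ 0F)) (inj₁ (inj₂ i)) (inj₂ i) tt refl (λ ()))
  where
  open GraphProperties K*[1, suc n ]
  toHub : ∀ v → Star _~_ v (inj₁ (inj₁ 0F))
  toHub (inj₁ (inj₁ 0F)) = ε
  toHub (inj₁ (inj₂ i))  = tt ◅ ε
  toHub (inj₂ i)         = _◅_ {j = inj₁ (inj₂ i)} refl (tt ◅ ε)

K₂ₙ-exceeds : ∀ n → Exceeds n K[ 2 , suc n ]
K₂ₙ-exceeds n = hub⇒connected (inj₁ 0F) toHub ,
  injection⇒≤#degree≥2 inj₂ (λ { refl → refl })
    (λ i → neighbours⇒branching (inj₁ 0F) (inj₂ i) (inj₁ 1F) tt tt (λ ()))
  where
  open GraphProperties K[ 2 , suc n ]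
  toHub : ∀ v → Star _~_ v (inj₁ 0F)
  -- Both hubs, the target included, walk through the first vertex of the other side, which `suc n`
  -- makes available.
  toHub (inj₁ h) = _◅_ {j = inj₂ 0F} tt (tt ◅ ε)
  toHub (inj₂ i) = tt ◅ ε

K₂+nK₁-exceeds : ∀ n → Exceeds n (K 2 +ᴳ suc n · K 1)
K₂+nK₁-exceeds n = hub⇒connected (inj₁ 0F) toHub ,
  injection⇒≤#degree≥2 (λ i → inj₂ (i , 0F)) (λ { refl → refl })
    (λ i → neighbours⇒branching (inj₁ 0F) (inj₂ (i , 0F)) (inj₁ 1F) tt tt (λ ()))
  where
  open GraphProperties (K 2 +ᴳ suc n · K 1)
  toHub : ∀ v → Star _~_ v (inj₁ 0F)
  toHub (inj₁ 0F) = ε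
  toHub (inj₁ 1F) = (λ ()) ◅ ε
  toHub (inj₂ _)  = tt ◅ ε

K₁+nK₂-exceeds : ∀ n → Exceeds n (K 1 +ᴳ suc n · K 2)
K₁+nK₂-exceeds n = hub⇒connected (inj₁ 0F) toHub ,
  injection⇒≤#degree≥2 (λ i → inj₂ (i , 0F)) (λ { refl → refl })
    (λ i → neighbours⇒branching (inj₁ 0F) (inj₂ (i , 0F)) (inj₂ (i , 1F)) tt (refl , λ ()) (λ ()))
  where
  open GraphProperties (K 1 +ᴳ suc n · K 2)
  toHub : ∀ v → Star _~_ v (inj₁ 0F)
  toHub (inj₁ 0F) = ε
  toHub (inj₂ _)  = tt ◅ ε

unavoidable-exceeds : ∀ C → All (Exceeds C) (unavoidable (3 + C))
unavoidable-exceeds C =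
  K-exceeds C ∷ P-exceeds C ∷
  -- These four graphs with parameter `3 + C` even exceed `2 + C`, which is weakened to `C`.
  All.map {P = Exceeds (2 + C)} (λ (conn , 2+C<) → conn , ≤-trans (s≤s (ℕ.m≤n+m C 2)) 2+C<)
    (K*-exceeds (2 + C) ∷ K₂ₙ-exceeds (2 + C) ∷ K₂+nK₁-exceeds (2 + C) ∷ K₁+nK₂-exceeds (2 + C) ∷ [])

theorem1p3 : ∀ {ℓ : Level} → ExcludedMiddle (lsuc 0ℓ ⊔ ℓ) → (ℋ : Pred Graph ℓ) →
    (∃[ C ] (∀ (G : Graph) → Connected G → G ∈ ℋ -Free → Graph.#degree≥2 G ≤ C))
    ⇔
    (∃[ n ] (n > 0 × ℋ ≼ (_∈ˡ (K n ∷ P n ∷ K*[1, n ] ∷ K[ 2 , n ] ∷ K 2 +ᴳ n · K 1 ∷ K 1 +ᴳ n · K 2 ∷ []))))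
theorem1p3 em ℋ = mk⇔ bounded⇒≼ ≼⇒bounded
  where
  bounded⇒≼ : (∃[ C ] (∀ G → Connected G → G ∈ ℋ -Free → Graph.#degree≥2 G ≤ C)) →
              ∃[ n ] (n > 0 × ℋ ≼ (_∈ˡ unavoidable n))
  bounded⇒≼ (C , bounded) = 3 + C , z<s , λ F F∈ →
    let conn , C< = All.lookup (unavoidable-exceeds C) F∈ in
    -- Were `F` free of members of `ℋ`, it would violate the bound. Excluded middle turns this
    -- refutation into an actual member of `ℋ` contained in `F`.
    decidable-stable em λ F-free → <⇒≱ C< (bounded F conn F-free)

  ≼⇒bounded : ∃[ n ] (n > 0 × ℋ ≼ (_∈ˡ unavoidable n)) →
              ∃[ C ] (∀ G → Connected G → G ∈ ℋ -Free → Graph.#degree≥2 G ≤ C)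
  -- Each of the six graphs contains a member of `ℋ`, so by transitivity an `ℋ`-free graph avoids
  -- all six.
  ≼⇒bounded (n , _ , ℋ≼) = ballBound (legBound n) n , λ G conn G-free →
    #degree≥2-bounded-by-avoiding {G = G}
      (λ {F} F∈ F≤G → let H , H∈ℋ , H≤F = ℋ≼ F F∈ in
        G-free (H , H∈ℋ , ≤ᴳ-trans {H} {F} {G} H≤F F≤G))
      conn
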